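{- The program $P_3$ is correct with respect to $S_3$ and complete with respect to $S_3^0$; that is, $S_3^0\subseteq \mathcal{M}_{P_3}\subseteq S_3$, where $\mathcal{M}_{P_3}$ is the least Herbrand model of $P_3$.
   Context: A fixed alphabet of function and predicate symbols is assumed, containing at least those occurring below (it may contain more); $\mathcal{HU}$ is the Herbrand universe (all ground terms), $\mathcal{HB}$ the Herbrand base (all ground atoms). Prolog list notation is used ($[\,]$ is a constant, $[h|t]$ a binary constructor, $[t_1,\ldots,t_i|s]$ as usual); $-$ is a binary function symbol written infix; $\mathtt{true},\mathtt{false}$ are constants. A specification is a subset $S$ of $\mathcal{HB}$; a program $P$ is correct w.r.t. $S$ if $\mathcal{M}_P\subseteq S$, and complete w.r.t. $S$ if $S\subseteq\mathcal{M}_P$. The definite clause program $P_3$ consists of the following rules (names beginning with upper-case letters are variables): 1. $sat\_cnf([\,])$. 2. $sat\_cnf([C|Cs])\gets sat\_cl(C), sat\_cnf(Cs)$. 3. $sat\_cl([P-V|R])\gets sat\_cl3(R,V,P)$. 4. ${=}(X,X)$. 5. $sat\_cl3([\,],V,P)\gets V=P$. 6. $sat\_cl3([P_2-V_2|R],V_1,P_1)\gets sat\_cl5(V_1,P_1,V_2,P_2,R)$. 7. $sat\_cl5(V_1,P_1,V_2,P_2,R)\gets sat\_cl5a(V_1,P_1,V_2,P_2,R)$. 8. $sat\_cl5(V_1,P_1,V_2,P_2,R)\gets sat\_cl5a(V_2,P_2,V_1,P_1,R)$. 9. $sat\_cl5a(V_1,P_1,V_2,P_2,R)\gets V_1=P_1$.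 10. $sat\_cl5a(V_1,P_1,V_2,P_2,R)\gets sat\_cl3(R,V_2,P_2)$. 11. $sat(Cs,Vs)\gets sat\_cnf(Cs), tflist(Vs)$. 12. $tflist([\,])$. 13. $tflist([V|Vs])\gets tflist(Vs), tf(V)$. 14. $tf(\mathtt{true})$. 15. $tf(\mathtt{false})$. Define the sets of ground terms $L_1=\{[t_1,\ldots,t_i|s]\in\mathcal{HU}\mid i>0,\ t_i=t-t\text{ for some }t\in\mathcal{HU}\}$, $L_2=\{[s_1,\ldots,s_n]\mid n\ge0,\ s_1,\ldots,s_n\in L_1\}$, $L_1^0=\{[t_1-t'_1,\ldots,t_n-t'_n]\in\mathcal{HU}\mid n>0,\ t_i=t'_i\text{ for some }i\in\{1,\ldots,n\}\}$, $L_2^0=\{[s_1,\ldots,s_n]\mid n\ge0,\ s_1,\ldots,s_n\in L_1^0\}$, $TFL=\{[t_1,\ldots,t_n]\mid n\ge0,\ \text{each }t_i\in\{\mathtt{true},\mathtt{false}\}\}$. The specification $S_3$ (for correctness) consists of the following ground atoms: $sat\_cl(s)$ for $s\in L_1$; $sat\_cnf(u)$ for $u\in L_2$; $t=t$ for $t\in\mathcal{HU}$; $sat\_cl3(s,v,p)$ for $[p-v|s]\in L_1$; $sat\_cl5(v_1,p_1,v_2,p_2,s)$ and $sat\_cl5a(v_1,p_1,v_2,p_2,s)$ for $[p_1-v_1,p_2-v_2|s]\in L_1$; $sat(u,t)$ for $u\in L_2$, $t\in TFL$; $tflist(t)$ for $t\in TFL$; $tf(\mathtt{true})$ and $tf(\mathtt{false})$.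 The specification $S_3^0$ (for completeness) is defined in the same way with $L_1,L_2$ replaced by $L_1^0,L_2^0$. -}

module Defs where

open import Data.Empty using (⊥)
open import Data.List using (List; []; _∷_; _∷ʳ_; foldr; map)
open import Data.List.Membership.Propositional using (_∈_)
open import Data.List.Relation.Unary.All using (All; []; _∷_)
open import Data.List.Relation.Unary.Any using (Any)
open import Data.Nat using (ℕ)
open import Data.Product using (_×_; ∃-syntax; uncurry)
open import Data.Sum using (_⊎_)
open import Data.Vec using (Vec; []; _∷_)
open import Level using (0ℓ)
open import Relation.Binary.PropositionalEquality using (_≡_)
open import Relation.Unary using (Pred; _⊆_)

-- Symbols are indexed by their arity.
record Alphabet : Set₁ where
  field
    Fun : ℕ → Set
    Rel : ℕ → Set

module Logic (𝒜 : Alphabet) where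
  open Alphabet 𝒜

  Var : Set
  Var = ℕ

  data Term (V : Set) : Set where
    var : V → Term V
    fn  : ∀ {n} → Fun n → Vec (Term V) n → Term V

  data Atom (V : Set) : Set where
    atom : ∀ {n} → Rel n → Vec (Term V) n → Atom V

  infix 4 _←_
  data Clause : Set where
    _←_ : Atom Var → List (Atom Var) → Clause

  Program : Set
  Program = List Clause

  HU : Set
  HU = Term ⊥

  HB : Set
  HB = Atom ⊥

  GroundSubst : Set
  GroundSubst = Var → HU

  mutual
    substT : GroundSubst → Term Var → HU
    substT θ (var x)   = θ x
    substT θ (fn f ts) = fn f (substTs θ ts)

    substTs : ∀ {n} → GroundSubst → Vec (Term Var) n → Vec HU n
    substTs θ []       = []
    substTs θ (t ∷ ts) = substT θ t ∷ substTs θ ts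

  substA : GroundSubst → Atom Var → HB
  substA θ (atom p ts) = atom p (substTs θ ts)

  IsHerbrandModel : ∀ {ℓ} → Program → Pred HB ℓ → Set ℓ
  IsHerbrandModel P I = ∀ {H Bs} (θ : GroundSubst) → (H ← Bs) ∈ P →
    All (λ B → I (substA θ B)) Bs → I (substA θ H)

  -- The least Herbrand model; `ℳ-model` and `ℳ-least` confirm that it is one.
  data ℳ (P : Program) : Pred HB 0ℓ where
    rule : ∀ {H Bs} (θ : GroundSubst) → (H ← Bs) ∈ P →
           All (λ B → ℳ P (substA θ B)) Bs → ℳ P (substA θ H)

  ℳ-model : ∀ P → IsHerbrandModel P (ℳ P)
  ℳ-model P = rule

  mutual
    ℳ-least : ∀ {ℓ} P (I : Pred HB ℓ) → IsHerbrandModel P I → ℳ P ⊆ I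
    ℳ-least P I m (rule θ c∈P bs) = m θ c∈P (ℳ-least* P I m θ bs)

    ℳ-least* : ∀ {ℓ} P (I : Pred HB ℓ) → IsHerbrandModel P I → ∀ θ {Bs} →
               All (λ B → ℳ P (substA θ B)) Bs → All (λ B → I (substA θ B)) Bs
    ℳ-least* P I m θ []       = []
    ℳ-least* P I m θ (b ∷ bs) = ℳ-least P I m b ∷ ℳ-least* P I m θ bs

  Specification : Set₁
  Specification = Pred HB 0ℓ

  Correct : Program → Specification → Set
  Correct P S = ℳ P ⊆ S

  Complete : Program → Specification → Set
  Complete P S = S ⊆ ℳ P

-- The symbols occurring in the program, plus arbitrary further symbols
-- given by an alphabet ℰ.
module SAT (ℰ : Alphabet) where

  data FunSym : ℕ → Set where
    nil   : FunSym 0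
    cons  : FunSym 2
    minus : FunSym 2
    true  : FunSym 0
    false : FunSym 0
    other : ∀ {n} → Alphabet.Fun ℰ n → FunSym n

  data RelSym : ℕ → Set where
    sat-cnf  : RelSym 1
    sat-cl   : RelSym 1
    eq       : RelSym 2
    sat-cl3  : RelSym 3
    sat-cl5  : RelSym 5
    sat-cl5a : RelSym 5
    sat      : RelSym 2
    tflist   : RelSym 1
    tf       : RelSym 1
    other    : ∀ {n} → Alphabet.Rel ℰ n → RelSym n

  𝒜 : Alphabet
  𝒜 = record { Fun = FunSym ; Rel = RelSym }

  open Logic 𝒜 public

  module _ {V : Set} where

    infixr 7 _▸_
    infix  8 _-_

    ‵[] ‵true ‵false : Term V
    ‵[]    = fn nil []
    ‵true  = fn true []
    ‵false = fn false []

    -- h ▸ t is the Prolog term [h|t].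
    _▸_ _-_ : Term V → Term V → Term V
    h ▸ t = fn cons (h ∷ t ∷ [])
    s - t = fn minus (s ∷ t ∷ [])

    -- [ t₁ ∷ … ∷ tᵢ ∷ [] ∣ s ] is the Prolog term [t₁,…,tᵢ|s].
    [_∣_] : List (Term V) → Term V → Term V
    [ ts ∣ s ] = foldr _▸_ s ts

    infix 6 _≐_
    _≐_ : Term V → Term V → Atom V
    s ≐ t = atom eq (s ∷ t ∷ [])

    ‵sat-cnf ‵sat-cl ‵tflist ‵tf : Term V → Atom V
    ‵sat-cnf t = atom sat-cnf (t ∷ [])
    ‵sat-cl  t = atom sat-cl (t ∷ [])
    ‵tflist  t = atom tflist (t ∷ [])
    ‵tf      t = atom tf (t ∷ [])

    ‵sat : Term V → Term V → Atom V
    ‵sat u t = atom sat (u ∷ t ∷ [])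

    ‵sat-cl3 : Term V → Term V → Term V → Atom V
    ‵sat-cl3 r v p = atom sat-cl3 (r ∷ v ∷ p ∷ [])

    ‵sat-cl5 ‵sat-cl5a : Term V → Term V → Term V → Term V → Term V → Atom V
    ‵sat-cl5  v₁ p₁ v₂ p₂ r = atom sat-cl5  (v₁ ∷ p₁ ∷ v₂ ∷ p₂ ∷ r ∷ [])
    ‵sat-cl5a v₁ p₁ v₂ p₂ r = atom sat-cl5a (v₁ ∷ p₁ ∷ v₂ ∷ p₂ ∷ r ∷ [])

  P₃ : Program
  P₃ =
      (‵sat-cnf ‵[]                  ← [])
    ∷ (‵sat-cnf (C ▸ Cs)             ← ‵sat-cl C ∷ ‵sat-cnf Cs ∷ [])
    ∷ (‵sat-cl (P - V ▸ R)           ← ‵sat-cl3 R V P ∷ [])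
    ∷ (X ≐ X                         ← [])
    ∷ (‵sat-cl3 ‵[] V P              ← V ≐ P ∷ [])
    ∷ (‵sat-cl3 (P₂ - V₂ ▸ R) V₁ P₁  ← ‵sat-cl5 V₁ P₁ V₂ P₂ R ∷ [])
    ∷ (‵sat-cl5 V₁ P₁ V₂ P₂ R        ← ‵sat-cl5a V₁ P₁ V₂ P₂ R ∷ [])
    ∷ (‵sat-cl5 V₁ P₁ V₂ P₂ R        ← ‵sat-cl5a V₂ P₂ V₁ P₁ R ∷ [])
    ∷ (‵sat-cl5a V₁ P₁ V₂ P₂ R       ← V₁ ≐ P₁ ∷ [])
    ∷ (‵sat-cl5a V₁ P₁ V₂ P₂ R       ← ‵sat-cl3 R V₂ P₂ ∷ [])
    ∷ (‵sat Cs Vs                    ← ‵sat-cnf Cs ∷ ‵tflist Vs ∷ [])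
    ∷ (‵tflist ‵[]                   ← [])
    ∷ (‵tflist (V ▸ Vs)              ← ‵tflist Vs ∷ ‵tf V ∷ [])
    ∷ (‵tf ‵true                     ← [])
    ∷ (‵tf ‵false                    ← [])
    ∷ []
    where
    C Cs P V R X P₁ V₁ P₂ V₂ Vs : Term Var
    C  = var 0
    Cs = var 1
    P  = var 2
    V  = var 3
    R  = var 4
    X  = var 5
    P₁ = var 6
    V₁ = var 7
    P₂ = var 8
    V₂ = var 9
    Vs = var 10

  ListsOver : Pred HU 0ℓ → Pred HU 0ℓ
  ListsOver L u = ∃[ ss ] (All L ss × u ≡ [ ss ∣ ‵[] ])

  -- The final prefix element is t - t; the tail s need not be a list.
  L₁ : Pred HU 0ℓ
  L₁ u = ∃[ ts ] ∃[ t ] ∃[ s ] u ≡ [ ts ∷ʳ (t - t) ∣ s ]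

  L₂ : Pred HU 0ℓ
  L₂ = ListsOver L₁

  -- `Any` forces the list of pairs to be nonempty.
  L₁⁰ : Pred HU 0ℓ
  L₁⁰ u = ∃[ ps ] (Any (uncurry _≡_) ps × u ≡ [ map (uncurry _-_) ps ∣ ‵[] ])

  L₂⁰ : Pred HU 0ℓ
  L₂⁰ = ListsOver L₁⁰

  TFL : Pred HU 0ℓ
  TFL = ListsOver (λ t → t ≡ ‵true ⊎ t ≡ ‵false)

  data Spec (K₁ K₂ : Pred HU 0ℓ) : Specification where
    sat-cl   : ∀ {s} → K₁ s → Spec K₁ K₂ (‵sat-cl s)
    sat-cnf  : ∀ {u} → K₂ u → Spec K₁ K₂ (‵sat-cnf u)
    eq       : ∀ t → Spec K₁ K₂ (t ≐ t)
    sat-cl3  : ∀ {s v p} → K₁ (p - v ▸ s) → Spec K₁ K₂ (‵sat-cl3 s v p)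
    sat-cl5  : ∀ {v₁ p₁ v₂ p₂ s} → K₁ (p₁ - v₁ ▸ p₂ - v₂ ▸ s) →
               Spec K₁ K₂ (‵sat-cl5 v₁ p₁ v₂ p₂ s)
    sat-cl5a : ∀ {v₁ p₁ v₂ p₂ s} → K₁ (p₁ - v₁ ▸ p₂ - v₂ ▸ s) →
               Spec K₁ K₂ (‵sat-cl5a v₁ p₁ v₂ p₂ s)
    sat      : ∀ {u t} → K₂ u → TFL t → Spec K₁ K₂ (‵sat u t)
    tflist   : ∀ {t} → TFL t → Spec K₁ K₂ (‵tflist t)
    tf-true  : Spec K₁ K₂ (‵tf ‵true)
    tf-false : Spec K₁ K₂ (‵tf ‵false)

  S₃ : Specification
  S₃ = Spec L₁ L₂

  S₃⁰ : Specification
  S₃⁰ = Spec L₁⁰ L₂⁰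

{-# OPTIONS --safe #-}

-- Correctness: S₃ is a Herbrand model of P₃, and ℳ P₃ is the least one.  Membership
-- in L₁ is stable under prepending an element and under swapping the first two.
-- Completeness: sat_cl3 succeeds on a clause by induction on the remaining pairs,
-- always delegating to the first or the second of the two pairs watched.
module Submission where

open import Data.Fin using (#_)
open import Data.List using (List; []; _∷_; map)
open import Data.List.Membership.Propositional.Properties using (∈-lookup)
open import Data.List.Relation.Unary.All as All using (All; []; _∷_)
open import Data.List.Relation.Unary.Any using (Any; here; there)
open import Data.Product using (_×_; _,_; uncurry)
open import Data.Sum using (_⊎_; inj₁; inj₂)
open import Level using (0ℓ)
open import Relation.Binary.PropositionalEquality using (_≡_; refl; sym)
open import Relation.Unary using (Pred; _⊆_)
open import Defs

module Correctness (ℰ : Alphabet) where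
  open SAT ℰ

  L₁-here : ∀ {p v s} → v ≡ p → L₁ (p - v ▸ s)
  L₁-here refl = [] , _ , _ , refl

  L₁-there : ∀ {u s} → L₁ s → L₁ (u ▸ s)
  L₁-there (ts , t , s , refl) = _ ∷ ts , t , s , refl

  -- Serves the clause that hands `sat-cl5a` the two watched pairs in reverse order. The entry
  -- `t - t` may sit first, second or later; in the first two cases the end of the prefix moves by
  -- one place.
  L₁-swap : ∀ {u w s} → L₁ (u ▸ w ▸ s) → L₁ (w ▸ u ▸ s)
  L₁-swap ([]         , t , _ , refl) = _ ∷ [] , t , _ , refl
  L₁-swap (_ ∷ []     , t , _ , refl) = [] , t , _ , refl
  L₁-swap (_ ∷ _ ∷ ts , t , s , refl) = _ ∷ _ ∷ ts , t , s , refl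

  ListsOver-[] : ∀ {L} → ListsOver L ‵[]
  ListsOver-[] = [] , [] , refl

  ListsOver-∷ : ∀ {L h u} → L h → ListsOver L u → ListsOver L (h ▸ u)
  ListsOver-∷ l (ts , ls , refl) = _ ∷ ts , l ∷ ls , refl

  -- In a clause body the sides are values of `θ`, where matching on `eq` would get stuck; variable
  -- sides unify. `tf-inv` serves the same purpose.
  ≐-inv : ∀ {K₁ K₂ s t} → Spec K₁ K₂ (s ≐ t) → s ≡ t
  ≐-inv (eq _) = refl

  tf-inv : ∀ {K₁ K₂ t} → Spec K₁ K₂ (‵tf t) → t ≡ ‵true ⊎ t ≡ ‵false
  tf-inv tf-true  = inj₁ refl
  tf-inv tf-false = inj₂ refl

  -- Being a model is split clause by clause, so that `P₃` is handled by an `All` list in program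
  -- order.
  Satisfies : Pred HB 0ℓ → Clause → Set
  Satisfies I (H ← Bs) = ∀ θ → All (λ B → I (substA θ B)) Bs → I (substA θ H)

  S₃-satisfies-P₃ : All (Satisfies S₃) P₃
  S₃-satisfies-P₃ =
      (λ { θ [] → sat-cnf ListsOver-[] })
    ∷ (λ { θ (sat-cl c ∷ sat-cnf cs ∷ []) → sat-cnf (ListsOver-∷ c cs) })
    ∷ (λ { θ (sat-cl3 l ∷ []) → sat-cl l })
    ∷ (λ { θ [] → eq _ })
    ∷ (λ { θ (e ∷ []) → sat-cl3 (L₁-here (≐-inv e)) })
    ∷ (λ { θ (sat-cl5 l ∷ []) → sat-cl3 l })
    ∷ (λ { θ (sat-cl5a l ∷ []) → sat-cl5 l })
    ∷ (λ { θ (sat-cl5a l ∷ []) → sat-cl5 (L₁-swap l) })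
    ∷ (λ { θ (e ∷ []) → sat-cl5a (L₁-here (≐-inv e)) })
    ∷ (λ { θ (sat-cl3 l ∷ []) → sat-cl5a (L₁-there l) })
    ∷ (λ { θ (sat-cnf cs ∷ tflist vs ∷ []) → sat cs vs })
    ∷ (λ { θ [] → tflist ListsOver-[] })
    ∷ (λ { θ (tflist vs ∷ v ∷ []) → tflist (ListsOver-∷ (tf-inv v) vs) })
    ∷ (λ { θ [] → tf-true })
    ∷ (λ { θ [] → tf-false })
    ∷ []

  correct : Correct P₃ S₃
  correct = ℳ-least P₃ S₃ (λ θ c∈P → All.lookup S₃-satisfies-P₃ c∈P θ)

module Completeness (ℰ : Alphabet) where
  open SAT ℰ

  clause : List (HU × HU) → HU
  clause ps = [ map (uncurry _-_) ps ∣ ‵[] ]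

  ≐-complete : ∀ {s t} → s ≡ t → ℳ P₃ (s ≐ t)
  -- Indices such as `# 3` count the clauses of `P₃` from zero.
  ≐-complete {s} refl = rule (λ _ → s) (∈-lookup (# 3)) []

  mutual
    -- The three lemmas call each other in a cycle that terminates because the cons case here passes
    -- on a shorter `ps`.
    cl3-complete : ∀ {p v} ps → Any (uncurry _≡_) ((p , v) ∷ ps) →
                   ℳ P₃ (‵sat-cl3 (clause ps) v p)
    cl3-complete {p} {v} [] (here p≡v) =
      rule (λ { 2 → p ; 3 → v ; _ → ‵[] }) (∈-lookup (# 4))
        -- The pair is `P - V`, but the body reads `V ≐ P`.
        (≐-complete (sym p≡v) ∷ [])
    cl3-complete {p} {v} ((p₂ , v₂) ∷ ps) a =
      -- The default branch supplies `R`, which is variable 4.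
      rule (λ { 6 → p ; 7 → v ; 8 → p₂ ; 9 → v₂ ; _ → clause ps }) (∈-lookup (# 5))
        (cl5-complete ps a ∷ [])

    cl5-complete : ∀ {p₁ v₁ p₂ v₂} ps →
                   Any (uncurry _≡_) ((p₁ , v₁) ∷ (p₂ , v₂) ∷ ps) →
                   ℳ P₃ (‵sat-cl5 v₁ p₁ v₂ p₂ (clause ps))
    cl5-complete {p₁} {v₁} {p₂} {v₂} ps a =
      -- The order of the pairs is kept: `cl5a-complete` covers an equality in the first pair as
      -- well as a later one.
      rule (λ { 6 → p₁ ; 7 → v₁ ; 8 → p₂ ; 9 → v₂ ; _ → clause ps }) (∈-lookup (# 6))
        (cl5a-complete ps a ∷ [])

    cl5a-complete : ∀ {p₁ v₁ p₂ v₂} ps →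
                    Any (uncurry _≡_) ((p₁ , v₁) ∷ (p₂ , v₂) ∷ ps) →
                    ℳ P₃ (‵sat-cl5a v₁ p₁ v₂ p₂ (clause ps))
    cl5a-complete {p₁} {v₁} {p₂} {v₂} ps (here p₁≡v₁) =
      rule (λ { 6 → p₁ ; 7 → v₁ ; 8 → p₂ ; 9 → v₂ ; _ → clause ps }) (∈-lookup (# 8))
        (≐-complete (sym p₁≡v₁) ∷ [])
    cl5a-complete {p₁} {v₁} {p₂} {v₂} ps (there a) =
      rule (λ { 6 → p₁ ; 7 → v₁ ; 8 → p₂ ; 9 → v₂ ; _ → clause ps }) (∈-lookup (# 9))
        (cl3-complete ps a ∷ [])

  cl-complete : ∀ {s} → L₁⁰ s → ℳ P₃ (‵sat-cl s)
  cl-complete ((p , v) ∷ ps , a , refl) =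
    rule (λ { 2 → p ; 3 → v ; _ → clause ps }) (∈-lookup (# 2))
      (cl3-complete ps a ∷ [])

  cnf-complete : L₂⁰ ⊆ λ u → ℳ P₃ (‵sat-cnf u)
  cnf-complete ([]     , []     , refl) = rule (λ _ → ‵[]) (∈-lookup (# 0)) []
  cnf-complete (s ∷ ss , l ∷ ls , refl) =
    rule (λ { 0 → s ; _ → [ ss ∣ ‵[] ] }) (∈-lookup (# 1))
      (cl-complete l ∷ cnf-complete (ss , ls , refl) ∷ [])

  tf-complete : ∀ {t} → t ≡ ‵true ⊎ t ≡ ‵false → ℳ P₃ (‵tf t)
  tf-complete (inj₁ refl) = rule (λ _ → ‵[]) (∈-lookup (# 13)) []
  tf-complete (inj₂ refl) = rule (λ _ → ‵[]) (∈-lookup (# 14)) []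

  tflist-complete : TFL ⊆ λ t → ℳ P₃ (‵tflist t)
  tflist-complete ([]     , []     , refl) = rule (λ _ → ‵[]) (∈-lookup (# 11)) []
  tflist-complete (t ∷ ts , b ∷ bs , refl) =
    rule (λ { 3 → t ; _ → [ ts ∣ ‵[] ] }) (∈-lookup (# 12))
      (tflist-complete (ts , bs , refl) ∷ tf-complete b ∷ [])

  complete : Complete P₃ S₃⁰
  complete (sat-cl l) = cl-complete l
  complete (sat-cnf l) = cnf-complete l
  complete (eq t) = ≐-complete refl
  -- Matching `refl` identifies the leading listed pairs with those in the atom and its tail with
  -- `clause ps`; shorter lists would equate a cons with `‵[]`.
  complete (sat-cl3 (_ ∷ ps , a , refl)) = cl3-complete ps a
  complete (sat-cl5 (_ ∷ _ ∷ ps , a , refl)) = cl5-complete ps a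
  complete (sat-cl5a (_ ∷ _ ∷ ps , a , refl)) = cl5a-complete ps a
  complete (sat {u} {t} l b) =
    rule (λ { 1 → u ; _ → t }) (∈-lookup (# 10))
      (cnf-complete l ∷ tflist-complete b ∷ [])
  complete (tflist b) = tflist-complete b
  complete tf-true = tf-complete (inj₁ refl)
  complete tf-false = tf-complete (inj₂ refl)

mainTheorem2 : (ℰ : Alphabet) → let open SAT ℰ in
    Correct P₃ S₃ × Complete P₃ S₃⁰
mainTheorem2 ℰ = Correctness.correct ℰ , Completeness.complete ℰ
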